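{- Let $k\ge 2$ and $2\le r\le k$ be integers, let $T=3^{k-r+1}$ and $M=3^{r-1}$, and let $S=(\mathcal{P},\mathcal{B})$ be a Steiner triple system on $|\mathcal{P}|=3^k$ points whose $3$-rank is at most $3^k-r$. Fix a decomposition of $S$ of the form described in the context (groups $G_x$, $x\in AG(r-1,3)$, sub-systems $\mathcal{B}_x$ and transversal designs $\mathcal{B}_\ell$). Suppose that (i) for every point $x$ of $AG(r-1,3)$, the Steiner triple system $(G_x,\mathcal{B}_x)$ on $T$ points is resolvable, and (ii) for every line $\ell$ of $AG(r-1,3)$, the Latin square of order $T$ corresponding to the transversal design $\mathcal{B}_\ell$ has an orthogonal mate. Then $S$ is resolvable, i.e. $\mathcal{B}$ can be partitioned into $\frac{3^k-1}{2}$ parallel classes.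
   Context: A Steiner triple system $STS(v)$ is a pair $(\mathcal{P},\mathcal{B})$ with $|\mathcal{P}|=v$ and $\mathcal{B}$ a set of $3$-subsets (blocks) of $\mathcal{P}$ such that every $2$-subset of $\mathcal{P}$ lies in exactly one block. Its $3$-rank is the rank over $\mathbb{F}_3$ of its block–point incidence matrix. A parallel class is a subset of $\mathcal{B}$ whose blocks partition $\mathcal{P}$; $S$ is resolvable if $\mathcal{B}$ can be partitioned into parallel classes. A transversal design $TD[3;T]$ on three pairwise disjoint groups $H_1,H_2,H_3$ of size $T$ is a set of $T^2$ triples $\{a,b,c\}$ with $a\in H_1,b\in H_2,c\in H_3$ such that every pair of points from two distinct groups lies in exactly one triple; equivalently it is a Latin square of order $T$ (rows indexed by $H_1$, columns by $H_2$, symbols by $H_3$). Two Latin squares of order $n$ are orthogonal if superimposing them yields each ordered pair of symbols exactly once; an orthogonal mate of a Latin square is a Latin square orthogonal to it. Decomposition (from the cited structure theorem of Jungnickel et al. for non-full-3-rank STS, used here as the standing setup): if $S$ is an $STS(3^k)$ of $3$-rank at most $3^k-r$, then the point set $\mathcal{P}$ is partitioned into $M=3^{r-1}$ groups $G_x$ of size $T=3^{k-r+1}$, indexed by the points $x$ of the affine geometry $AG(r-1,3)$, and the block set splits as $\mathcal{B}=\bigcup_x \mathcal{B}_x\ \cup\ \bigcup_\ell \mathcal{B}_\ell$, where for each point $x$, $(G_x,\mathcal{B}_x)$ is an $STS(T)$, and for each line $\ell=\{x,y,z\}$ of $AG(r-1,3)$, $\mathcal{B}_\ell$ is a set of $T^2$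 blocks forming a transversal design $TD[3;T]$ on the three groups $G_x,G_y,G_z$. -}

module Defs where

open import Level using (0ℓ)
open import Data.Bool using (if_then_else_)
open import Data.Nat using (ℕ; _≤_)
import Data.Nat as ℕ
open import Data.Nat.DivMod using (_mod_)
open import Data.Fin using (Fin; toℕ)
open import Data.Fin.Patterns using (0F; 1F; 2F)
open import Data.Fin.Subset using (Subset; _∈_; _∉_; _⊆_; ⁅_⁆; _∪_; ∣_∣)
open import Data.Fin.Subset.Properties using (_∈?_)
open import Data.Vec using (Vec; replicate; zipWith; map)
open import Data.Vec.Functional using (Vector; foldr)
open import Data.Product using (Σ; ∃; ∃₂; ∃!; _×_; _,_)
open import Function.Bundles using (_⇔_)
open import Function.Definitions using (Injective)
open import Relation.Binary.PropositionalEquality using (_≡_; _≢_)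
open import Relation.Nullary.Decidable using (does)
open import Relation.Unary using (Pred)
  renaming (_⊆_ to _⊆ₚ_; _∪_ to _∪ₚ_; _≐_ to _≐ₚ_; ⋃ to ⋃ₚ)

F₃ : Set
F₃ = Fin 3

infixl 6 _+₃_
infixl 7 _*₃_

_+₃_ _*₃_ : F₃ → F₃ → F₃
a +₃ b = (toℕ a ℕ.+ toℕ b) mod 3
a *₃ b = (toℕ a ℕ.* toℕ b) mod 3

-- Rows of a matrix are indexed by an arbitrary type, because the
-- rows of an incidence matrix are indexed by the blocks themselves.
linearCombination : ∀ {m n} → Vector F₃ m → (Fin m → Vector F₃ n) → Vector F₃ n
linearCombination c u j = foldr _+₃_ 0F (λ i → c i *₃ u i j)

LinearlyIndependent : ∀ {m n} → (Fin m → Vector F₃ n) → Set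
LinearlyIndependent u =
  ∀ c → (∀ j → linearCombination c u j ≡ 0F) → ∀ i → c i ≡ 0F

-- ρ is the dimension of the row space: some ρ rows form a basis of it.
HasRank₃ : ∀ {I : Set} {n} → (I → Vector F₃ n) → ℕ → Set
HasRank₃ {I} A ρ = Σ (Fin ρ → I) λ row →
  LinearlyIndependent (λ i → A (row i)) ×
  (∀ i → ∃ λ c → ∀ j → A i j ≡ linearCombination c (λ t → A (row t)) j)

Rank₃≤ : ∀ {I : Set} {n} → (I → Vector F₃ n) → ℕ → Set
Rank₃≤ A m = ∃ λ ρ → HasRank₃ A ρ × ρ ≤ m

-- All point sets are subsets of an ambient Fin n.  Sets of blocks are
-- predicates; decidability is not assumed, since it follows from the
-- axioms of a Steiner triple system or transversal design.
BlockSet : ℕ → Set₁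
BlockSet n = Pred (Subset n) 0ℓ

record IsSTS {n} (v : ℕ) (P : Subset n) (𝓑 : BlockSet n) : Set where
  field
    order     : ∣ P ∣ ≡ v
    block-⊆   : ∀ {B} → 𝓑 B → B ⊆ P
    blockSize : ∀ {B} → 𝓑 B → ∣ B ∣ ≡ 3
    pair      : ∀ {p q} → p ∈ P → q ∈ P → p ≢ q →
                ∃! _≡_ λ B → 𝓑 B × p ∈ B × q ∈ B

incidenceMatrix : ∀ {n} (𝓑 : BlockSet n) → ∃ 𝓑 → Vector F₃ n
incidenceMatrix 𝓑 (B , _) p = if does (p ∈? B) then 1F else 0F

record IsParallelClass {n} (P : Subset n) (𝓑 𝓒 : BlockSet n) : Set where
  field
    ⊆-blocks : 𝓒 ⊆ₚ 𝓑
    block-⊆  : ∀ {B} → 𝓒 B → B ⊆ P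
    cover    : ∀ {p} → p ∈ P → ∃! _≡_ λ B → 𝓒 B × p ∈ B

ResolvableInto : ∀ {n} → ℕ → Subset n → BlockSet n → Set₁
ResolvableInto {n} m P 𝓑 = Σ (Fin m → BlockSet n) λ 𝓒 →
  (∀ i → IsParallelClass P 𝓑 (𝓒 i)) ×
  (∀ {B} → 𝓑 B → ∃! _≡_ λ i → 𝓒 i B)

Resolvable : ∀ {n} → Subset n → BlockSet n → Set₁
Resolvable P 𝓑 = ∃ λ m → ResolvableInto m P 𝓑

-- f lists the elements of Q without repetition, so that Q has m elements.
Enumerates : ∀ {m} {A : Set} → (Fin m → A) → Pred A 0ℓ → Set
Enumerates f Q = Injective _≡_ _≡_ f × (∀ x → Q x ⇔ ∃ λ i → f i ≡ x)

triple : ∀ {n} → Fin n → Fin n → Fin n → Subset n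
triple a b c = ⁅ a ⁆ ∪ ⁅ b ⁆ ∪ ⁅ c ⁆

record IsTD₃ {n} (T : ℕ) (H : Fin 3 → Subset n) (𝓣 : BlockSet n) : Set where
  field
    groupSize  : ∀ t → ∣ H t ∣ ≡ T
    disjoint   : ∀ {s t p} → s ≢ t → p ∈ H s → p ∉ H t
    transverse : ∀ {B} → 𝓣 B → ∃ λ a → ∃₂ λ b c →
                 a ∈ H 0F × b ∈ H 1F × c ∈ H 2F × B ≡ triple a b c
    blockCount : ∃ λ (f : Fin (T ℕ.* T) → Subset n) → Enumerates f 𝓣
    pair       : ∀ {s t p q} → s ≢ t → p ∈ H s → q ∈ H t →
                 ∃! _≡_ λ B → 𝓣 B × p ∈ B × q ∈ B

Square : ℕ → Set
Square T = Fin T → Fin T → Fin T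

record IsLatinSquare {T} (L : Square T) : Set where
  field
    inRow    : ∀ i s → ∃! _≡_ λ j → L i j ≡ s
    inColumn : ∀ j s → ∃! _≡_ λ i → L i j ≡ s

Orthogonal : ∀ {T} → Square T → Square T → Set
Orthogonal {T} L L′ =
  ∀ s s′ → ∃! {A = Fin T × Fin T} _≡_ λ (i , j) → L i j ≡ s × L′ i j ≡ s′

HasOrthogonalMate : ∀ {T} → Square T → Set
HasOrthogonalMate L = ∃ λ L′ → IsLatinSquare L′ × Orthogonal L L′

-- L is the Latin square of the design 𝓣 once the groups H 0F (rows),
-- H 1F (columns) and H 2F (symbols) have been numbered by e.
CorrespondsTo : ∀ {n T} → Square T → (Fin 3 → Subset n) → BlockSet n → Set
CorrespondsTo {n} {T} L H 𝓣 = Σ (Fin 3 → Fin T → Fin n) λ e →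
  (∀ t → Enumerates (e t) (_∈ H t)) ×
  (∀ i j s → L i j ≡ s ⇔ 𝓣 (triple (e 0F i) (e 1F j) (e 2F s)))

Point : ℕ → Set
Point d = Vec F₃ d

-- A line of AG(d,3) is presented by a base point and a direction.  As a
-- set of points it has six presentations, one for each ordering of its
-- three points; _≈ₗ_ identifies them.
record Line (d : ℕ) : Set where
  field
    base        : Point d
    direction   : Point d
    direction≢0 : direction ≢ replicate d 0F

  point : F₃ → Point d
  point t = zipWith _+₃_ base (map (t *₃_) direction)

open Line public using (point)

_on_ : ∀ {d} → Point d → Line d → Set
x on ℓ = ∃ λ t → x ≡ point ℓ t

_≈ₗ_ : ∀ {d} → Line d → Line d → Set
ℓ ≈ₗ ℓ′ = (_on ℓ) ≐ₚ (_on ℓ′)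

record Decomposition {n} (d T : ℕ) (𝓑 : BlockSet n) : Set₁ where
  field
    G         : Point d → Subset n
    partition : ∀ p → ∃! _≡_ λ x → p ∈ G x
    𝓑pt       : Point d → BlockSet n
    𝓑ln       : Line d → BlockSet n
    -- 𝓑ln depends on the line only, not on its presentation
    𝓑ln-cong  : ∀ {ℓ ℓ′} → ℓ ≈ₗ ℓ′ → 𝓑ln ℓ ≐ₚ 𝓑ln ℓ′

  groupsOn : Line d → Fin 3 → Subset n
  groupsOn ℓ t = G (point ℓ t)

  field
    union     : 𝓑 ≐ₚ (⋃ₚ (Point d) 𝓑pt ∪ₚ ⋃ₚ (Line d) 𝓑ln)
    subsystem : ∀ x → IsSTS T (G x) (𝓑pt x)
    design    : ∀ ℓ → IsTD₃ T (groupsOn ℓ) (𝓑ln ℓ)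

  -- The Latin square of the design on ℓ, for some ordering of the three
  -- groups (a presentation ℓ′ of the same line) and some numbering of
  -- rows, columns and symbols, has an orthogonal mate.  Whether a mate
  -- exists does not depend on these choices.
  LatinSquareHasMate : Line d → Set
  LatinSquareHasMate ℓ = ∃ λ ℓ′ → ℓ′ ≈ₗ ℓ × (∃ λ (L : Square T) →
    CorrespondsTo L (groupsOn ℓ′) (𝓑ln ℓ′) × HasOrthogonalMate L)

{-# OPTIONS --safe #-}

-- The lines in a fixed direction partition the points of AG(d,3), hence
-- their groups partition the points of S.  An orthogonal mate splits the
-- transversal design on each of these lines into T parallel classes, and
-- joining the classes with the same symbol over all lines of the
-- direction gives T parallel classes of S.  There are (3^d − 1)/2
-- directions.  The remaining blocks lie in the subsystems, each of which
-- has exactly (T − 1)/2 parallel classes; these are joined over all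
-- points of AG(d,3).
module Submission where

open import Defs
open import Data.Nat using (ℕ; zero; suc; _≤_; _+_; _*_; _∸_; _^_; _/_)
import Data.Nat.Properties as ℕ
open import Data.Nat.DivMod using (m*n/n≡m)
open import Data.Nat.Solver using (module +-*-Solver)
open import Data.Fin using (Fin; zero; suc; combine; remQuot; fromℕ<; _≟_)
open import Data.Fin.Patterns using (0F; 1F; 2F)
open import Data.Fin.Properties
  using (all?; suc-injective; injective⇒≤; remQuot-combine; combine-remQuot; 0↔⊥; +↔⊎; *↔×)
open import Data.Fin.Subset using (Subset; _∈_; _∉_; _⊆_; ⁅_⁆; _∪_; _-_; ∣_∣; ⊤; inside; outside)
open import Data.Fin.Subset.Properties
  using (x∈⁅x⁆; x∈⁅y⁆⇒x≡y; x∈p∪q⁺; x∈p∪q⁻; p─⊥≡p; p─q⊆p; x∈p∧x≢y⇒x∈p-y;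
         ∈⊤)
open import Data.Vec using ([]; _∷_; here; there; replicate; zipWith; map)
open import Data.Vec.Properties using (∷-injectiveˡ; ∷-injectiveʳ)
open import Data.Product using (Σ; ∃; ∃₂; ∃!; _×_; _,_; proj₁; proj₂; uncurry)
open import Data.Product.Function.NonDependent.Propositional using (_×-↔_)
open import Data.Sum using (_⊎_; inj₁; inj₂)
open import Data.Sum.Function.Propositional using (_⊎-↔_)
open import Data.Empty using (⊥; ⊥-elim)
open import Function using (_∘_)
open import Function.Bundles using (mk⇔; _↔_; mk↔ₛ′; module Equivalence; module Inverse)
open import Function.Properties.Inverse using (↔-refl; ↔-trans)
open import Relation.Binary.PropositionalEquality
open import Relation.Nullary using (yes; no; ¬?; _→-dec_)
open import Relation.Nullary.Decidable using (from-yes)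

-- Lines of AG(d,3)

-- Directions up to scalar multiples, normalised so that the first
-- nonzero coordinate is 1.
Direction : ℕ → Set
Direction zero    = ⊥
Direction (suc d) = Point d ⊎ Direction d

vector : ∀ {d} → Direction d → Point d
vector {suc d} (inj₁ v) = 1F ∷ v
vector {suc d} (inj₂ δ) = 0F ∷ vector δ

vector≢0 : ∀ {d} (δ : Direction d) → vector δ ≢ replicate d 0F
vector≢0 {suc d} (inj₂ δ) eq = vector≢0 δ (∷-injectiveʳ eq)

-- a v is subtracted, as −1 = 2.
shift : F₃ → F₃ → F₃ → F₃
shift a v x = x +₃ 2F *₃ a *₃ v

-- The point of the line through x in direction δ whose coordinate at the
-- leading position of δ vanishes.
foot : ∀ {d} → Direction d → Point d → Point d
foot {suc d} (inj₁ v) (a ∷ x) = 0F ∷ zipWith (shift a) v x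
foot {suc d} (inj₂ δ) (a ∷ x) = a ∷ foot δ x

-- The parameter of `x` on its line in direction `δ`: at the leading position the base point has 0
-- and the direction has 1.
lead : ∀ {d} → Direction d → Point d → F₃
lead {suc d} (inj₁ v) (a ∷ x) = a
lead {suc d} (inj₂ δ) (a ∷ x) = lead δ x

-- Based at `foot δ x` rather than at `x`, so that all points of one line yield the same
-- presentation and lines in direction `δ` can be compared by their feet.
lineThrough : ∀ {d} → Direction d → Point d → Line d
lineThrough δ x = record
  { base = foot δ x ; direction = vector δ ; direction≢0 = vector≢0 δ }

lineThrough-cong : ∀ {d} {δ : Direction d} {x y} →
                   foot δ x ≡ foot δ y → lineThrough δ x ≡ lineThrough δ y
lineThrough-cong {δ = δ} = cong λ b → record
  { base = b ; direction = vector δ ; direction≢0 = vector≢0 δ }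

-- Arithmetic of F₃ by exhaustive check, then coordinatewise

+₃-*₃-0 : ∀ a t → a +₃ t *₃ 0F ≡ a
+₃-*₃-0 = from-yes (all? λ a → all? λ t → (a +₃ t *₃ 0F) ≟ a)

0-+₃-*₃-1 : ∀ t → 0F +₃ t *₃ 1F ≡ t
0-+₃-*₃-1 = from-yes (all? λ t → (0F +₃ t *₃ 1F) ≟ t)

+₃-cancel-shift : ∀ a v x → shift a v x +₃ a *₃ v ≡ x
+₃-cancel-shift = from-yes (all? λ a → all? λ v → all? λ x →
  (shift a v x +₃ a *₃ v) ≟ x)

shift-+₃ : ∀ t a v x → shift t v (shift a v x +₃ t *₃ v) ≡ shift a v x
shift-+₃ = from-yes (all? λ t → all? λ a → all? λ v → all? λ x →
  shift t v (shift a v x +₃ t *₃ v) ≟ shift a v x)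

-- (y − x)/(b − a), since nonzero elements of F₃ are their own inverses.
slope : F₃ → F₃ → F₃ → F₃ → F₃
slope a b x y = (b +₃ 2F *₃ a) *₃ (y +₃ 2F *₃ x)

shift-slope : ∀ a b → a ≢ b → ∀ x y →
              shift a (slope a b x y) x ≡ shift b (slope a b x y) y
shift-slope = from-yes (all? λ a → all? λ b → ¬? (a ≟ b) →-dec all? λ x → all? λ y →
  shift a (slope a b x y) x ≟ shift b (slope a b x y) y)

slope-unique : ∀ a b → a ≢ b → ∀ x y v → shift a v x ≡ shift b v y → slope a b x y ≡ v
slope-unique = from-yes (all? λ a → all? λ b → ¬? (a ≟ b) →-dec all? λ x → all? λ y →
  all? λ v → (shift a v x ≟ shift b v y) →-dec (slope a b x y ≟ v))

zipWith-+₃-cancel-shift : ∀ {d} a (v x : Point d) →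
  zipWith _+₃_ (zipWith (shift a) v x) (map (a *₃_) v) ≡ x
zipWith-+₃-cancel-shift a []      []      = refl
zipWith-+₃-cancel-shift a (v ∷ w) (x ∷ y) =
  cong₂ _∷_ (+₃-cancel-shift a v x) (zipWith-+₃-cancel-shift a w y)

zipWith-shift-+₃ : ∀ {d} t a (v x : Point d) →
  zipWith (shift t) v (zipWith _+₃_ (zipWith (shift a) v x) (map (t *₃_) v)) ≡
  zipWith (shift a) v x
zipWith-shift-+₃ t a []      []      = refl
zipWith-shift-+₃ t a (v ∷ w) (x ∷ y) =
  cong₂ _∷_ (shift-+₃ t a v x) (zipWith-shift-+₃ t a w y)

-- When the leading coordinates `a` and `b` differ, each further coordinate of a normalised
-- direction joining the two points is forced to be the slope.
zipWith-shift-slope : ∀ {d} {a b} → a ≢ b → (x y : Point d) →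
  ∃! _≡_ λ v → zipWith (shift a) v x ≡ zipWith (shift b) v y
zipWith-shift-slope a≢b [] [] = [] , refl , λ { {[]} _ → refl }
zipWith-shift-slope {a = a} {b} a≢b (x ∷ xs) (y ∷ ys)
  with v , eq , uniq ← zipWith-shift-slope a≢b xs ys =
    slope a b x y ∷ v
  , cong₂ _∷_ (shift-slope a b a≢b x y) eq
  , λ { {w ∷ ws} eq′ → cong₂ _∷_ (slope-unique a b a≢b x y w (∷-injectiveˡ eq′))
                                 (uniq (∷-injectiveʳ eq′)) }

-- Incidence of points with lines in a given direction

point-lead : ∀ {d} (δ : Direction d) x → point (lineThrough δ x) (lead δ x) ≡ x
point-lead {suc d} (inj₁ v) (a ∷ x) =
  cong₂ _∷_ (0-+₃-*₃-1 a) (zipWith-+₃-cancel-shift a v x)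
point-lead {suc d} (inj₂ δ) (a ∷ x) = cong₂ _∷_ (+₃-*₃-0 a (lead δ x)) (point-lead δ x)

-- Moving along the direction changes only the multiple that `foot` subtracts. With
-- `on-lineThrough`, the fibres of `foot δ` are exactly the lines in direction `δ`.
foot-point : ∀ {d} (δ : Direction d) x t → foot δ (point (lineThrough δ x) t) ≡ foot δ x
foot-point {suc d} (inj₁ v) (a ∷ x) t rewrite 0-+₃-*₃-1 t =
  cong (0F ∷_) (zipWith-shift-+₃ t a v x)
foot-point {suc d} (inj₂ δ) (a ∷ x) t = cong₂ _∷_ (+₃-*₃-0 a t) (foot-point δ x t)

on-lineThrough : ∀ {d} (δ : Direction d) {x y} → foot δ y ≡ foot δ x → y on lineThrough δ x
on-lineThrough δ {x} {y} eq = lead δ y ,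
  trans (sym (point-lead δ y)) (cong (λ ℓ → point ℓ (lead δ y)) (lineThrough-cong {δ = δ} eq))

-- Two distinct points span one line. Its direction leads at the first coordinate where they differ,
-- and the slopes determine the rest.
common-direction : ∀ {d} {x y : Point d} → x ≢ y → ∃! _≡_ λ δ → foot δ x ≡ foot δ y
common-direction {x = []}    {[]}    x≢y = ⊥-elim (x≢y refl)
common-direction {x = a ∷ x} {b ∷ y} x≢y with a ≟ b
... | no a≢b with v , eq , uniq ← zipWith-shift-slope a≢b x y =
    inj₁ v , cong (0F ∷_) eq
  , λ { {inj₁ w} eq′ → cong inj₁ (uniq (∷-injectiveʳ eq′))
      ; {inj₂ δ} eq′ → ⊥-elim (a≢b (∷-injectiveˡ eq′)) }
... | yes refl with δ , eq , uniq ← common-direction (x≢y ∘ cong (a ∷_)) =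
    inj₂ δ , cong (a ∷_) eq
  -- A direction leading here would subtract the same `a v` from both points, so equal feet would
  -- force `x ≡ y`.
  , λ { {inj₁ v} eq′ → ⊥-elim (x≢y (cong (a ∷_) (shift-injective v (∷-injectiveʳ eq′))))
      ; {inj₂ ε} eq′ → cong inj₂ (uniq (∷-injectiveʳ eq′)) }
  where
  shift-injective : ∀ v → zipWith (shift a) v x ≡ zipWith (shift a) v y → x ≡ y
  shift-injective v eq = begin
    x                                                     ≡⟨ zipWith-+₃-cancel-shift a v x ⟨
    zipWith _+₃_ (zipWith (shift a) v x) (map (a *₃_) v)  ≡⟨ cong (λ u → zipWith _+₃_ u (map (a *₃_) v)) eq ⟩
    zipWith _+₃_ (zipWith (shift a) v y) (map (a *₃_) v)  ≡⟨ zipWith-+₃-cancel-shift a v y ⟩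
    y                                                     ∎
    where open ≡-Reasoning

-- A coincidence at two different parameters makes every coordinate of the direction vanish.
point-injective : ∀ {d} (ℓ : Line d) {s t} → s ≢ t → point ℓ s ≢ point ℓ t
point-injective ℓ {s} {t} s≢t = Line.direction≢0 ℓ ∘ zero-direction (Line.base ℓ) (Line.direction ℓ)
  where
  zero-coordinate : ∀ s t → s ≢ t → ∀ b v → b +₃ s *₃ v ≡ b +₃ t *₃ v → v ≡ 0F
  zero-coordinate = from-yes (all? λ s → all? λ t → ¬? (s ≟ t) →-dec all? λ b → all? λ v →
    ((b +₃ s *₃ v) ≟ (b +₃ t *₃ v)) →-dec (v ≟ 0F))
  zero-direction : ∀ {d} (b v : Point d) →
    zipWith _+₃_ b (map (s *₃_) v) ≡ zipWith _+₃_ b (map (t *₃_) v) → v ≡ replicate d 0F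
  zero-direction []       []       _  = refl
  zero-direction (b ∷ bs) (v ∷ vs) eq =
    cong₂ _∷_ (zero-coordinate s t s≢t b v (∷-injectiveˡ eq))
              (zero-direction bs vs (∷-injectiveʳ eq))

-- Counting directions

#directions : ℕ → ℕ
#directions zero    = 0
#directions (suc d) = 3 ^ d + #directions d

-- A division-free form of (3^d - 1)/2, of the same shape as the count of classes in a subsystem.
1+2#directions : ∀ d → 1 + #directions d * 2 ≡ 3 ^ d
1+2#directions zero    = refl
1+2#directions (suc d) = begin
  1 + (3 ^ d + #directions d) * 2      ≡⟨ solve 2 (λ p c → con 1 :+ (p :+ c) :* con 2 :=
                                            con 2 :* p :+ (con 1 :+ c :* con 2)) refl
                                            (3 ^ d) (#directions d) ⟩
  2 * 3 ^ d + (1 + #directions d * 2)  ≡⟨ cong (2 * 3 ^ d +_) (1+2#directions d) ⟩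
  2 * 3 ^ d + 3 ^ d                    ≡⟨ ℕ.+-comm (2 * 3 ^ d) (3 ^ d) ⟩
  3 ^ suc d                            ∎
  where
  open ≡-Reasoning
  open +-*-Solver

Fin↔Point : ∀ d → Fin (3 ^ d) ↔ Point d
Fin↔Point zero    = mk↔ₛ′ (λ _ → []) (λ _ → 0F) (λ { [] → refl }) (λ { 0F → refl ; (suc ()) })
Fin↔Point (suc d) = ↔-trans *↔× (↔-trans (↔-refl ×-↔ Fin↔Point d)
  (mk↔ₛ′ (uncurry _∷_) (λ { (a ∷ x) → a , x }) (λ { (_ ∷ _) → refl }) (λ _ → refl)))

Fin↔Direction : ∀ d → Fin (#directions d) ↔ Direction d
Fin↔Direction zero    = 0↔⊥
Fin↔Direction (suc d) = ↔-trans +↔⊎ (Fin↔Point d ⊎-↔ Fin↔Direction d)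

-- Finite subsets

⋃₃ : ∀ {n} → (Fin 3 → Subset n) → Subset n
⋃₃ H = H 0F ∪ H 1F ∪ H 2F

∈⋃₃⁺ : ∀ {n} (H : Fin 3 → Subset n) t → H t ⊆ ⋃₃ H
∈⋃₃⁺ H 0F p∈ = x∈p∪q⁺ (inj₁ p∈)
∈⋃₃⁺ H 1F p∈ = x∈p∪q⁺ (inj₂ (x∈p∪q⁺ (inj₁ p∈)))
∈⋃₃⁺ H 2F p∈ = x∈p∪q⁺ (inj₂ (x∈p∪q⁺ (inj₂ p∈)))

∈⋃₃⁻ : ∀ {n} (H : Fin 3 → Subset n) {p} → p ∈ ⋃₃ H → ∃ λ t → p ∈ H t
∈⋃₃⁻ H p∈ with x∈p∪q⁻ (H 0F) (H 1F ∪ H 2F) p∈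
... | inj₁ p∈₀ = 0F , p∈₀
... | inj₂ p∈₁₂ with x∈p∪q⁻ (H 1F) (H 2F) p∈₁₂
...   | inj₁ p∈₁ = 1F , p∈₁
...   | inj₂ p∈₂ = 2F , p∈₂

-- Turns a cardinality into a listing, so that sizes can be compared through injections.
enumerate : ∀ {n} (S : Subset n) {m} → ∣ S ∣ ≡ m →
            ∃ λ (f : Fin m → Fin n) → Enumerates f (_∈ S)
enumerate [] refl = (λ ()) , (λ { {()} }) , λ ()
enumerate (outside ∷ S) refl with f , inj , onto ← enumerate S refl =
    suc ∘ f , (λ eq → inj (suc-injective eq))
  , λ { zero    → mk⇔ (λ ()) (λ { (_ , ()) })
      ; (suc x) → mk⇔ (λ { (there x∈) → let i , eq = to (onto x) x∈ in i , cong suc eq })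
                      (λ { (i , eq) → there (from (onto x) (i , suc-injective eq)) }) }
  where open Equivalence
enumerate {suc n} (inside ∷ S) refl with f , inj , onto ← enumerate S refl = g
  , (λ { {zero} {zero} _ → refl ; {suc i} {suc j} eq → cong suc (inj (suc-injective eq)) })
  , λ { zero    → mk⇔ (λ _ → zero , refl) (λ _ → here)
      ; (suc x) → mk⇔ (λ { (there x∈) → let i , eq = to (onto x) x∈ in suc i , cong suc eq })
                      (λ { (suc i , eq) → there (from (onto x) (i , suc-injective eq)) }) }
  where
  open Equivalence
  g : Fin (suc ∣ S ∣) → Fin (suc n)
  g zero    = zero
  g (suc i) = suc (f i)

-- Sending `i` to the position of `f i` in the list `g` is injective.
Enumerates-≤ : ∀ {a b} {A : Set} {Q : A → Set} {f : Fin a → A} {g : Fin b → A} →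
               Enumerates f Q → Enumerates g Q → a ≤ b
Enumerates-≤ {Q = Q} {f} {g} (f-inj , f-onto) (_ , g-onto) =
  injective⇒≤ {f = proj₁ ∘ preimage} λ {i} {j} eq →
    f-inj (trans (sym (proj₂ (preimage i))) (trans (cong g eq) (proj₂ (preimage j))))
  where
  open Equivalence
  preimage : ∀ i → ∃ λ j → g j ≡ f i
  preimage i = to (g-onto (f i)) (from (f-onto (f i)) (i , refl))

Enumerates-size : ∀ {a b} {A : Set} {Q : A → Set} {f : Fin a → A} {g : Fin b → A} →
                  Enumerates f Q → Enumerates g Q → a ≡ b
Enumerates-size ef eg = ℕ.≤-antisym (Enumerates-≤ ef eg) (Enumerates-≤ eg ef)

1+∣S-x∣≡∣S∣ : ∀ {n} {S : Subset n} {x} → x ∈ S → suc ∣ S - x ∣ ≡ ∣ S ∣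
1+∣S-x∣≡∣S∣ {S = inside  ∷ S} here        = cong (suc ∘ ∣_∣) (p─⊥≡p S)
1+∣S-x∣≡∣S∣ {S = inside  ∷ S} (there x∈S) = cong suc (1+∣S-x∣≡∣S∣ x∈S)
1+∣S-x∣≡∣S∣ {S = outside ∷ S} (there x∈S) = 1+∣S-x∣≡∣S∣ x∈S

x∉S-x : ∀ {n} {S : Subset n} {x} → x ∉ S - x
x∉S-x {S = inside  ∷ S} {zero}  ()
x∉S-x {S = outside ∷ S} {zero}  ()
x∉S-x {S = _       ∷ S} {suc x} (there x∈) = x∉S-x x∈

-- Resolutions

-- Classes may be indexed by any type, so that directions and symbols can serve as indices before
-- they are numbered.
ResolvableBy : ∀ {n} → Set → Subset n → BlockSet n → Set₁
ResolvableBy {n} I P 𝓑 = Σ (I → BlockSet n) λ 𝓒 →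
  (∀ i → IsParallelClass P 𝓑 (𝓒 i)) × (∀ {B} → 𝓑 B → ∃! _≡_ λ i → 𝓒 i B)

reindex : ∀ {n m} {I : Set} {P : Subset n} {𝓑 : BlockSet n} →
          Fin m ↔ I → ResolvableBy I P 𝓑 → ResolvableInto m P 𝓑
reindex φ (𝓒 , parallel , class) = 𝓒 ∘ to , parallel ∘ to , λ {B} B∈ →
  let i , B∈i , uniq = class B∈ in
  from i , subst (λ j → 𝓒 j B) (sym (strictlyInverseˡ i)) B∈i ,
  λ {j} B∈j → trans (cong from (uniq B∈j)) (strictlyInverseʳ j)
  where open Inverse φ

-- Each class contains one block through p, and these blocks without p
-- partition the remaining points into pairs.
resolution-size : ∀ {n v m} {P : Subset n} {𝓑 : BlockSet n} {p} →
                  IsSTS v P 𝓑 → p ∈ P → ResolvableInto m P 𝓑 → 1 + m * 2 ≡ v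
resolution-size {n} {v} {m} {P} {𝓑} {p} sts p∈P (𝓒 , parallel , class) =
  trans (cong suc (Enumerates-size g-enumerates (proj₂ (enumerate (P - p) refl))))
        (trans (1+∣S-x∣≡∣S∣ p∈P) (IsSTS.order sts))
  where
  open Equivalence
  open IsParallelClass
  open IsSTS sts using (blockSize; pair)

  blockAt : ∀ i → ∃! _≡_ λ B → 𝓒 i B × p ∈ B
  blockAt i = cover (parallel i) p∈P

  block : Fin m → Subset n
  block i = proj₁ (blockAt i)

  block∈𝓒 : ∀ i → 𝓒 i (block i)
  block∈𝓒 i = proj₁ (proj₁ (proj₂ (blockAt i)))

  p∈block : ∀ i → p ∈ block i
  p∈block i = proj₂ (proj₁ (proj₂ (blockAt i)))

  block∈𝓑 : ∀ i → 𝓑 (block i)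
  block∈𝓑 i = ⊆-blocks (parallel i) (block∈𝓒 i)

  others : ∀ i → ∃ λ (f : Fin 2 → Fin n) → Enumerates f (_∈ block i - p)
  others i = enumerate (block i - p)
    (ℕ.suc-injective (trans (1+∣S-x∣≡∣S∣ (p∈block i)) (blockSize (block∈𝓑 i))))

  other : Fin m → Fin 2 → Fin n
  other i = proj₁ (others i)

  other∈ : ∀ i u → other i u ∈ block i - p
  other∈ i u = from (proj₂ (proj₂ (others i)) _) (u , refl)

  other∈block : ∀ i u → other i u ∈ block i
  other∈block i u = p─q⊆p (block i) ⁅ p ⁆ (other∈ i u)

  other≢p : ∀ i u → other i u ≢ p
  other≢p i u eq = x∉S-x (subst (_∈ block i - p) eq (other∈ i u))

  other∈P-p : ∀ i u → other i u ∈ P - p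
  other∈P-p i u = x∈p∧x≢y⇒x∈p-y (block-⊆ (parallel i) (block∈𝓒 i) (other∈block i u)) (other≢p i u)

  block-injective : ∀ {i j} → block i ≡ block j → i ≡ j
  block-injective {i} {j} eq with _ , _ , uniq ← class (block∈𝓑 i) =
    trans (sym (uniq (block∈𝓒 i))) (uniq (subst (𝓒 j) (sym eq) (block∈𝓒 j)))

  other-injective : ∀ i j u w → other i u ≡ other j w → (i , u) ≡ (j , w)
  other-injective i j u w eq with block-injective {i} {j} same-block
    where
    -- Both blocks contain `p` and the common other point, and only one block does.
    same-block : block i ≡ block j
    same-block with _ , _ , uniq ← pair p∈P (p─q⊆p P ⁅ p ⁆ (other∈P-p i u)) (other≢p i u ∘ sym) =
      trans (sym (uniq (block∈𝓑 i , p∈block i , other∈block i u)))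
            (uniq (block∈𝓑 j , p∈block j , subst (_∈ block j) (sym eq) (other∈block j w)))
  ... | refl = cong (i ,_) (proj₁ (proj₂ (others i)) eq)

  other-surjective : ∀ {q} → q ∈ P - p → ∃₂ λ i u → other i u ≡ q
  other-surjective {q} q∈ with p ≟ q
  ... | yes refl = ⊥-elim (x∉S-x q∈)
  ... | no p≢q
    with B , (B∈𝓑 , p∈B , q∈B) , _ ← pair p∈P (p─q⊆p P ⁅ p ⁆ q∈) p≢q
    with i , B∈i , _ ← class B∈𝓑
    -- The block joining `p` and `q` must be the one that its class `i` has through `p`.
    with refl ← proj₂ (proj₂ (blockAt i)) (B∈i , p∈B) =
      i , to (proj₂ (proj₂ (others i)) q) (x∈p∧x≢y⇒x∈p-y q∈B (p≢q ∘ sym))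

  g : Fin (m * 2) → Fin n
  g = uncurry other ∘ remQuot 2

  g-enumerates : Enumerates g (_∈ P - p)
  g-enumerates = g-injective , λ q → mk⇔ g-surjective λ { (k , refl) → uncurry other∈P-p (remQuot 2 k) }
    where
    g-injective : ∀ {k l} → g k ≡ g l → k ≡ l
    g-injective {k} {l} eq = begin
      k                                 ≡⟨ combine-remQuot {m} 2 k ⟨
      uncurry combine (remQuot {m} 2 k) ≡⟨ cong (uncurry combine) (other-injective _ _ _ _ eq) ⟩
      uncurry combine (remQuot {m} 2 l) ≡⟨ combine-remQuot {m} 2 l ⟩
      l                                 ∎
      where open ≡-Reasoning
    g-surjective : ∀ {q} → q ∈ P - p → ∃ λ k → g k ≡ q
    g-surjective q∈ with i , u , eq ← other-surjective q∈ =
      combine i u , trans (cong (uncurry other) (remQuot-combine i u)) eq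

-- The cells holding a given symbol of the mate form a parallel class.
mate⇒resolvable : ∀ {n T} {H : Fin 3 → Subset n} {𝓣 : BlockSet n} {L : Square T} →
                  IsTD₃ T H 𝓣 → CorrespondsTo L H 𝓣 → HasOrthogonalMate L →
                  ResolvableInto T (⋃₃ H) 𝓣
mate⇒resolvable {n} {T} {H} {𝓣} {L} td (e , e-enum , L⇔𝓣) (L′ , latin , orthogonal) =
  𝓒 , parallel , class
  where
  open Equivalence
  open IsTD₃ td using (disjoint; transverse)
  open IsLatinSquare latin

  e∈ : ∀ t u → e t u ∈ H t
  e∈ t u = from (proj₂ (e-enum t) _) (u , refl)

  number : ∀ t {p} → p ∈ H t → ∃ λ u → e t u ≡ p
  number t {p} = to (proj₂ (e-enum t) p)

  Cell : Set
  Cell = Fin T × Fin T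

  coordinate : Cell → Fin 3 → Fin T
  coordinate (i , j) 0F = i
  coordinate (i , j) 1F = j
  coordinate (i , j) 2F = L i j

  vertex : Cell → Fin 3 → Fin n
  vertex c t = e t (coordinate c t)

  -- Unfolds to the `triple` of the three vertices, as `CorrespondsTo` requires.
  block : Cell → Subset n
  block c = ⋃₃ (⁅_⁆ ∘ vertex c)

  block∈𝓣 : ∀ c → 𝓣 (block c)
  block∈𝓣 (i , j) = to (L⇔𝓣 i j (L i j)) refl

  vertex∈block : ∀ c t → vertex c t ∈ block c
  vertex∈block c t = ∈⋃₃⁺ (⁅_⁆ ∘ vertex c) t (x∈⁅x⁆ _)

  -- The groups are disjoint, so the only point of a block in group `t` is its vertex there.
  e∈block⇒coordinate : ∀ c t {u} → e t u ∈ block c → coordinate c t ≡ u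
  e∈block⇒coordinate c t {u} e∈block with ∈⋃₃⁻ (⁅_⁆ ∘ vertex c) e∈block
  ... | t′ , e∈vertex with x∈⁅y⁆⇒x≡y _ e∈vertex | t ≟ t′
  ...   | eq | yes refl = proj₁ (e-enum t) (sym eq)
  ...   | eq | no t≢t′  = ⊥-elim (disjoint t≢t′ (e∈ t u) (subst (_∈ H t′) (sym eq) (e∈ t′ _)))

  block-injective : ∀ {c c′} → block c ≡ block c′ → c ≡ c′
  block-injective {c} {c′} eq = cong₂ _,_ (agree 0F) (agree 1F)
    where
    agree : ∀ t → coordinate c t ≡ coordinate c′ t
    agree t = e∈block⇒coordinate c t (subst (vertex c′ t ∈_) (sym eq) (vertex∈block c′ t))

  -- The reason the classes cover each point once: the symbol `s` of the mate occurs once in each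
  -- row and each column, as the mate is Latin, and once together with each symbol of `L`, by
  -- orthogonality. These cases are the three groups.
  locate : ∀ t u s → ∃! _≡_ λ c → coordinate c t ≡ u × uncurry L′ c ≡ s
  locate 0F i s with j , eq , uniq ← inRow i s =
    (i , j) , (refl , eq) , λ { (refl , eq′) → cong (i ,_) (uniq eq′) }
  locate 1F j s with i , eq , uniq ← inColumn j s =
    (i , j) , (refl , eq) , λ { (refl , eq′) → cong (_, j) (uniq eq′) }
  locate 2F u s = orthogonal u s

  𝓒 : Fin T → BlockSet n
  𝓒 s B = ∃ λ c → uncurry L′ c ≡ s × B ≡ block c

  cover : ∀ s {p} → p ∈ ⋃₃ H → ∃! _≡_ λ B → 𝓒 s B × p ∈ B
  cover s p∈ with t , p∈t ← ∈⋃₃⁻ H p∈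
             with u , refl ← number t p∈t
             with c , (refl , eq) , uniq ← locate t u s =
      block c , ((c , eq , refl) , vertex∈block c t)
    , λ { ((c′ , eq′ , refl) , p∈B) → cong block (uniq (e∈block⇒coordinate c′ t p∈B , eq′)) }

  block⊆ : ∀ c → block c ⊆ ⋃₃ H
  block⊆ c p∈ with t , p∈t ← ∈⋃₃⁻ (⁅_⁆ ∘ vertex c) p∈
              with refl ← x∈⁅y⁆⇒x≡y _ p∈t = ∈⋃₃⁺ H t (e∈ t _)

  parallel : ∀ s → IsParallelClass (⋃₃ H) 𝓣 (𝓒 s)
  parallel s = record
    { ⊆-blocks = λ { (c , _ , refl) → block∈𝓣 c }
    ; block-⊆  = λ { (c , _ , refl) → block⊆ c }
    ; cover    = cover s }

  class : ∀ {B} → 𝓣 B → ∃! _≡_ λ s → 𝓒 s B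
  class B∈𝓣 with a , b , c , a∈ , b∈ , c∈ , refl ← transverse B∈𝓣
            with i , refl ← number 0F a∈
            with j , refl ← number 1F b∈
            with s , refl ← number 2F c∈
            -- The third point carries the symbol `L i j`, so the block is that of the cell
            -- `(i , j)`.
            with refl ← from (L⇔𝓣 i j s) B∈𝓣 =
      L′ i j , ((i , j) , refl , refl)
    , λ { (c′ , refl , eq) → cong (uncurry L′) (block-injective {i , j} {c′} eq) }

-- Joining the classes of subsystems and designs

decomposition-resolvable : ∀ {n v d T m} {𝓑 : BlockSet n} → IsSTS v ⊤ 𝓑 →
  (D : Decomposition d T 𝓑) → let open Decomposition D in
  (∀ x → ResolvableInto m (G x) (𝓑pt x)) →
  (∀ ℓ → ResolvableInto T (⋃₃ (groupsOn ℓ)) (𝓑ln ℓ)) →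
  ResolvableBy (Fin m ⊎ (Direction d × Fin T)) ⊤ 𝓑
decomposition-resolvable {n} {v} {d} {T} {m} {𝓑} sts D resolvePt resolveLn =
  𝓒 , parallel , class
  where
  open Decomposition D
  open IsParallelClass
  module Ln ℓ = IsTD₃ (design ℓ)

  𝓑pt⊆𝓑 : ∀ {x B} → 𝓑pt x B → 𝓑 B
  𝓑pt⊆𝓑 B∈ = proj₂ union (inj₁ (_ , B∈))

  𝓑ln⊆𝓑 : ∀ {ℓ B} → 𝓑ln ℓ B → 𝓑 B
  𝓑ln⊆𝓑 B∈ = proj₂ union (inj₂ (_ , B∈))

  same-group : ∀ {p x y} → p ∈ G x → p ∈ G y → x ≡ y
  same-group {p} p∈x p∈y with _ , _ , uniq ← partition p = trans (sym (uniq p∈x)) (uniq p∈y)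

  Gℓ : Direction d → Point d → Subset n
  Gℓ δ x = ⋃₃ (groupsOn (lineThrough δ x))

  ∈Gℓ⁺ : ∀ δ {p x y} → foot δ x ≡ foot δ y → p ∈ G x → p ∈ Gℓ δ y
  ∈Gℓ⁺ δ {y = y} eq p∈x with t , refl ← on-lineThrough δ eq =
    ∈⋃₃⁺ (groupsOn (lineThrough δ y)) t p∈x

  ∈Gℓ⁻ : ∀ δ {p x y} → p ∈ Gℓ δ y → p ∈ G x → foot δ x ≡ foot δ y
  ∈Gℓ⁻ δ {y = y} p∈ p∈x with t , p∈t ← ∈⋃₃⁻ (groupsOn (lineThrough δ y)) p∈
                        with refl ← same-group p∈x p∈t = foot-point δ y t

  ptClass : Point d → Fin m → BlockSet n
  ptClass x = proj₁ (resolvePt x)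

  ptParallel : ∀ x i → IsParallelClass (G x) (𝓑pt x) (ptClass x i)
  ptParallel x = proj₁ (proj₂ (resolvePt x))

  lnClass : Line d → Fin T → BlockSet n
  lnClass ℓ = proj₁ (resolveLn ℓ)

  lnParallel : ∀ ℓ s → IsParallelClass (⋃₃ (groupsOn ℓ)) (𝓑ln ℓ) (lnClass ℓ s)
  lnParallel ℓ = proj₁ (proj₂ (resolveLn ℓ))

  -- In the second case each line arises from all of its points `x`, but always in the same
  -- presentation, hence with the same class.
  𝓒 : Fin m ⊎ (Direction d × Fin T) → BlockSet n
  𝓒 (inj₁ i)       B = ∃ λ x → ptClass x i B
  𝓒 (inj₂ (δ , s)) B = ∃ λ x → lnClass (lineThrough δ x) s B

  parallel : ∀ i → IsParallelClass ⊤ 𝓑 (𝓒 i)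
  parallel (inj₁ i) = record
    { ⊆-blocks = λ { (x , B∈) → 𝓑pt⊆𝓑 (⊆-blocks (ptParallel x i) B∈) }
    ; block-⊆  = λ _ _ → ∈⊤
    ; cover    = λ {p} _ → coverPt p }
    where
    coverPt : ∀ p → ∃! _≡_ λ B → 𝓒 (inj₁ i) B × p ∈ B
    coverPt p with x , p∈x , _ ← partition p
              with B , (B∈ , p∈B) , uniq ← cover (ptParallel x i) p∈x =
        B , ((x , B∈) , p∈B)
      , λ { {B′} ((y , B′∈) , p∈B′) → uniq (subst (λ z → ptClass z i B′)
              (same-group (block-⊆ (ptParallel y i) B′∈ p∈B′) p∈x) B′∈ , p∈B′) }
  parallel (inj₂ (δ , s)) = record
    { ⊆-blocks = λ { (x , B∈) → 𝓑ln⊆𝓑 (⊆-blocks (lnParallel (lineThrough δ x) s) B∈) }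
    ; block-⊆  = λ _ _ → ∈⊤
    ; cover    = λ {p} _ → coverLn p }
    where
    coverLn : ∀ p → ∃! _≡_ λ B → 𝓒 (inj₂ (δ , s)) B × p ∈ B
    coverLn p with x , p∈x , _ ← partition p
              with B , (B∈ , p∈B) , uniq ← cover (lnParallel (lineThrough δ x) s) (∈Gℓ⁺ δ refl p∈x) =
        B , ((x , B∈) , p∈B)
      -- If the line through `y` supplies a block containing `p`, then `y` and `x` have the same
      -- foot, so both name one line and uniqueness on it applies.
      , λ { {B′} ((y , B′∈) , p∈B′) → uniq (subst (λ ℓ → lnClass ℓ s B′)
              (lineThrough-cong {δ = δ} {y} {x}
                (sym (∈Gℓ⁻ δ (block-⊆ (lnParallel (lineThrough δ y) s) B′∈ p∈B′) p∈x)))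
              B′∈ , p∈B′) }

  -- Two points in different groups keep such a block out of every subsystem and later determine its
  -- direction.
  crosses : ∀ {ℓ B} → 𝓑ln ℓ B →
    ∃₂ λ x y → x ≢ y × ∃₂ λ a b → a ∈ G x × b ∈ G y × a ∈ B × b ∈ B
  crosses {ℓ} B∈ with a , b , c , a∈ , b∈ , _ , refl ← Ln.transverse ℓ B∈ =
    point ℓ 0F , point ℓ 1F , point-injective ℓ {0F} {1F} (λ ()) , a , b , a∈ , b∈ ,
    x∈p∪q⁺ (inj₁ (x∈⁅x⁆ a)) , x∈p∪q⁺ (inj₂ (x∈p∪q⁺ (inj₁ (x∈⁅x⁆ b))))

  ¬pt∩ln : ∀ {x ℓ B} → 𝓑pt x B → 𝓑ln ℓ B → ⊥
  ¬pt∩ln {x} B∈x B∈ℓ with _ , _ , y≢z , _ , _ , a∈y , b∈z , a∈B , b∈B ← crosses B∈ℓ =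
    y≢z (trans (same-group a∈y (block-⊆x B∈x a∈B)) (same-group (block-⊆x B∈x b∈B) b∈z))
    where open IsSTS (subsystem x) using () renaming (block-⊆ to block-⊆x)

  -- A block has three points, hence at least one, and the group of that point determines `x`.
  𝓑pt-disjoint : ∀ {x y B} → 𝓑pt x B → 𝓑pt y B → x ≡ y
  𝓑pt-disjoint {x} {y} {B} B∈x B∈y with f , _ , onto ← enumerate B (IsSTS.blockSize (subsystem x) B∈x) =
    same-group (IsSTS.block-⊆ (subsystem x) B∈x f₀∈B) (IsSTS.block-⊆ (subsystem y) B∈y f₀∈B)
    where
    f₀∈B : f 0F ∈ B
    f₀∈B = Equivalence.from (onto (f 0F)) (0F , refl)

  ln-⊆ : ∀ {ℓ B} → 𝓑ln ℓ B → B ⊆ ⋃₃ (groupsOn ℓ)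
  ln-⊆ {ℓ} B∈ p∈B with s , B∈s , _ ← proj₂ (proj₂ (resolveLn ℓ)) B∈ =
    block-⊆ (lnParallel ℓ s) B∈s p∈B

  classPt : ∀ {x B} → 𝓑pt x B → ∃! _≡_ λ i → 𝓒 i B
  classPt {x} {B} B∈ with i , B∈i , uniq ← proj₂ (proj₂ (resolvePt x)) B∈ =
      inj₁ i , (x , B∈i)
    , λ { {inj₁ j} (y , B∈j) → cong inj₁ (uniq (subst (λ z → ptClass z j B)
            (𝓑pt-disjoint (⊆-blocks (ptParallel y j) B∈j) B∈) B∈j))
        ; {inj₂ (δ , s)} (y , B∈s) → ⊥-elim (¬pt∩ln B∈ (⊆-blocks (lnParallel _ s) B∈s)) }

  -- The design on `ℓ` has a block through `a` and `b`, and `S` has only one such block.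
  𝓑ln-joining : ∀ {ℓ B x y a b} → x on ℓ → y on ℓ → x ≢ y →
    a ∈ G x → b ∈ G y → 𝓑 B → a ∈ B → b ∈ B → 𝓑ln ℓ B
  𝓑ln-joining {ℓ} {B} (s , refl) (t , refl) x≢y a∈x b∈y B∈ a∈B b∈B
    with B′ , (B′∈ , a∈B′ , b∈B′) , _ ← Ln.pair ℓ {s} {t} (x≢y ∘ cong (point ℓ)) a∈x b∈y
    with _ , _ , uniq ← IsSTS.pair sts ∈⊤ ∈⊤ (λ { refl → x≢y (same-group a∈x b∈y) }) =
    subst (𝓑ln ℓ) (trans (sym (uniq (𝓑ln⊆𝓑 B′∈ , a∈B′ , b∈B′))) (uniq (B∈ , a∈B , b∈B))) B′∈

  -- B also belongs to the design of the normalised presentation of ℓ,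
  -- being the only block of S through two of its points.
  classLn : ∀ {ℓ B} → 𝓑ln ℓ B → ∃! _≡_ λ i → 𝓒 i B
  classLn {ℓ} {B} B∈
    with x , y , x≢y , a , b , a∈x , b∈y , a∈B , b∈B ← crosses B∈
    with δ , foot-eq , δ-uniq ← common-direction x≢y
    with s , B∈s , s-uniq ← proj₂ (proj₂ (resolveLn (lineThrough δ x)))
           (𝓑ln-joining (on-lineThrough δ {x} refl) (on-lineThrough δ {x} (sym foot-eq)) x≢y
                        a∈x b∈y (𝓑ln⊆𝓑 B∈) a∈B b∈B) =
      inj₂ (δ , s) , (x , B∈s) , λ {i} → unique i
    where
    unique : ∀ i → 𝓒 i B → inj₂ (δ , s) ≡ i
    unique (inj₁ i)       (z , B∈i) = ⊥-elim (¬pt∩ln (⊆-blocks (ptParallel z i) B∈i) B∈)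
    -- The block meets the groups of `x` and `y`, so both points lie on the line through `z` in
    -- direction `ε`; this forces `ε` to be `δ`.
    unique (inj₂ (ε , r)) (z , B∈r)
      with foot-x ← ∈Gℓ⁻ ε {y = z} (block-⊆ (lnParallel _ r) B∈r a∈B) a∈x
      with foot-y ← ∈Gℓ⁻ ε {y = z} (block-⊆ (lnParallel _ r) B∈r b∈B) b∈y
      with refl ← δ-uniq (trans foot-x (sym foot-y)) =
      cong (λ r → inj₂ (δ , r)) (s-uniq (subst (λ ℓ → lnClass ℓ r B)
        (lineThrough-cong {δ = δ} {z} {x} (sym foot-x)) B∈r))

  class : ∀ {B} → 𝓑 B → ∃! _≡_ λ i → 𝓒 i B
  class B∈ with proj₁ union B∈
  ... | inj₁ (x , B∈x) = classPt B∈x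
  ... | inj₂ (ℓ , B∈ℓ) = classLn B∈ℓ

-- The mate may belong to another presentation `ℓ′`. The resolution carries over, because the block
-- set and the union of the groups depend only on the points of the line.
resolvable-on-line : ∀ {n d T} {𝓑 : BlockSet n} (D : Decomposition d T 𝓑) →
  let open Decomposition D in
  ∀ ℓ → LatinSquareHasMate ℓ → ResolvableInto T (⋃₃ (groupsOn ℓ)) (𝓑ln ℓ)
resolvable-on-line D ℓ (ℓ′ , ℓ′≈ℓ , L , L~ , mate)
  with 𝓒 , parallel , class ← mate⇒resolvable (Decomposition.design D ℓ′) L~ mate = 𝓒
  , (λ s → record
      { ⊆-blocks = proj₁ (𝓑ln-cong ℓ′≈ℓ) ∘ ⊆-blocks (parallel s)
      ; block-⊆  = λ B∈s → ⋃-mono {ℓ′} {ℓ} (proj₁ ℓ′≈ℓ) ∘ block-⊆ (parallel s) B∈s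
      ; cover    = cover (parallel s) ∘ ⋃-mono {ℓ} {ℓ′} (proj₂ ℓ′≈ℓ) })
  , class ∘ proj₂ (𝓑ln-cong ℓ′≈ℓ)
  where
  open Decomposition D
  open IsParallelClass
  ⋃-mono : ∀ {k m} → (∀ {x} → x on k → x on m) → ⋃₃ (groupsOn k) ⊆ ⋃₃ (groupsOn m)
  ⋃-mono {k} {m} k⊆m {p} p∈ with t , p∈t ← ∈⋃₃⁻ (groupsOn k) p∈ with u , eq ← k⊆m (t , refl) =
    ∈⋃₃⁺ (groupsOn m) u (subst (λ x → p ∈ G x) eq p∈t)

-- Conclusion with the number of classes

theorem3p7 : (k r : ℕ) → 2 ≤ k → 2 ≤ r → r ≤ k →
    (𝓑 : BlockSet (3 ^ k)) → IsSTS (3 ^ k) ⊤ 𝓑 →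
    Rank₃≤ (incidenceMatrix 𝓑) (3 ^ k ∸ r) →
    (D : Decomposition (r ∸ 1) (3 ^ (k ∸ r + 1)) 𝓑) →
    let open Decomposition D in
    (∀ x → Resolvable (G x) (𝓑pt x)) →
    (∀ ℓ → LatinSquareHasMate ℓ) →
    ResolvableInto ((3 ^ k ∸ 1) / 2) ⊤ 𝓑
theorem3p7 k r _ 2≤r r≤k 𝓑 sts _ D resolvable mates =
  subst (λ c → ResolvableInto c ⊤ 𝓑) (half total)
    (reindex (↔-trans +↔⊎ (↔-refl ⊎-↔ ↔-trans *↔× (Fin↔Direction d ×-↔ ↔-refl)))
      (decomposition-resolvable sts D resolvePt (λ ℓ → resolvable-on-line D ℓ (mates ℓ))))
  where
  open Decomposition D
  open ≡-Reasoning

  d T m : ℕ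
  d = r ∸ 1
  T = 3 ^ (k ∸ r + 1)
  m = (T ∸ 1) / 2

  half : ∀ {c v} → 1 + c * 2 ≡ v → c ≡ (v ∸ 1) / 2
  half {c} refl = sym (m*n/n≡m c 2)

  -- `T` is a power of 3, hence positive, so each group has a point at which classes can be counted.
  size : ∀ x {c} → ResolvableInto c (G x) (𝓑pt x) → 1 + c * 2 ≡ T
  size x with f , _ , onto ← enumerate (G x) (IsSTS.order (subsystem x)) =
    resolution-size (subsystem x) (Equivalence.from (onto _) (fromℕ< (ℕ.m^n>0 3 (k ∸ r + 1)) , refl))

  -- The hypothesis lets the number of classes vary with `x`. The count makes it `m` for every
  -- group, so the classes can be joined index by index.
  resolvePt : ∀ x → ResolvableInto m (G x) (𝓑pt x)
  resolvePt x with c , res ← resolvable x =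
    subst (λ c → ResolvableInto c (G x) (𝓑pt x)) (half (size x res)) res

  1+2m≡T : 1 + m * 2 ≡ T
  1+2m≡T = size (replicate d 0F) (resolvePt _)

  -- The bounds on `r` ensure that neither truncated subtraction cuts off.
  exponents : k ∸ r + 1 + d ≡ k
  exponents = begin
    k ∸ r + 1 + (r ∸ 1)    ≡⟨ ℕ.+-assoc (k ∸ r) 1 (r ∸ 1) ⟩
    k ∸ r + (1 + (r ∸ 1))  ≡⟨ cong (k ∸ r +_) (ℕ.m+[n∸m]≡n (ℕ.<⇒≤ 2≤r)) ⟩
    k ∸ r + r              ≡⟨ ℕ.m∸n+n≡m r≤k ⟩
    k                      ∎

  -- Twice the number of classes plus one factors as `T` times 3^d, by the counts for subsystems and
  -- for directions.
  total : 1 + (m + #directions d * T) * 2 ≡ 3 ^ k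
  total = begin
    1 + (m + #directions d * T) * 2      ≡⟨ solve 3 (λ m c t → con 1 :+ (m :+ c :* t) :* con 2 :=
                                              con 1 :+ m :* con 2 :+ t :* (c :* con 2)) refl
                                              m (#directions d) T ⟩
    1 + m * 2 + T * (#directions d * 2)  ≡⟨ cong (_+ T * (#directions d * 2)) 1+2m≡T ⟩
    T + T * (#directions d * 2)          ≡⟨ ℕ.*-suc T (#directions d * 2) ⟨
    T * (1 + #directions d * 2)          ≡⟨ cong (T *_) (1+2#directions d) ⟩
    T * 3 ^ d                            ≡⟨ ℕ.^-distribˡ-+-* 3 (k ∸ r + 1) d ⟨
    3 ^ (k ∸ r + 1 + d)                  ≡⟨ cong (3 ^_) exponents ⟩
    3 ^ k                                ∎
    where open +-*-Solver
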